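{- Let $E$ be an equivalence relation on a Polish space $X$. If $E$ is Borel graphable, then its Friedman–Stanley jump $E^+$ is also Borel graphable.
   Context: $E$ is Borel graphable if there is a Borel simple undirected graph $G\subseteq X\times X$ whose connectedness relation (connected by a finite path) equals $E$. The Friedman–Stanley jump $E^+$ is the equivalence relation on $X^\mathbb{N}$ given by $(x_i)E^+(y_i)$ iff $\{[x_i]_E:i\in\mathbb{N}\}=\{[y_i]_E:i\in\mathbb{N}\}$. -}

module Defs where

open import Level using (Level; 0ℓ; suc; _⊔_)
open import Data.Empty using (⊥-elim)
open import Data.Maybe.Base using (Maybe; just)
open import Data.Nat.Base as ℕ using (ℕ)
import Data.Nat.Properties as ℕ
open import Data.Product using (∃; ∃₂; Σ-syntax; ∃-syntax; _×_; _,_; proj₁; proj₂; uncurry)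
open import Data.Product.Relation.Binary.Pointwise.NonDependent using (×-setoid)
open import Data.Rational.Base as ℚ using (ℚ; 0ℚ; 1ℚ)
import Data.Rational.Properties as ℚ
open import Data.Unit.Base using (tt)
open import Function.Base using (_∘_)
open import Function.Bundles using (_⇔_)
open import Relation.Binary.Bundles using (Setoid)
open import Relation.Binary.Core using (Rel; _⇒_)
open import Relation.Binary.Definitions using (Symmetric; Irreflexive; _Respects_; tri<; tri≈; tri>)
open import Relation.Binary.PropositionalEquality.Core using (_≡_; refl; sym; trans; cong; subst)
open import Relation.Binary.Structures using (IsEquivalence)
open import Relation.Unary using (Pred; _∈_; _∉_; _⊆_; _≐_; _∩_; ∁; U; ⋃; _⟨×⟩_; _≬_; Universal)
open import Relation.Unary.Properties using (≐-refl; ≐-sym; ≐-trans)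

-- Real numbers: Dedekind's lower cuts without a greatest element.

record ℝ : Set₁ where
  field
    cut       : Pred ℚ 0ℓ
    inhabited : ∃[ q ] q ∈ cut
    proper    : ∃[ q ] q ∉ cut
    downward  : ∀ {p q} → p ℚ.< q → q ∈ cut → p ∈ cut
    no-max    : ∀ {p} → p ∈ cut → ∃[ q ] p ℚ.< q × q ∈ cut

open ℝ using (cut)

infix  4 _≃_ _≤_ _<_
infixl 6 _+_

_≃_ : Rel ℝ 0ℓ
a ≃ b = cut a ≐ cut b

_≤_ : Rel ℝ 0ℓ
a ≤ b = cut a ⊆ cut b

_<_ : Rel ℝ 0ℓ
a < b = ∃[ q ] q ∈ cut b × q ∉ cut a

fromℚ : ℚ → ℝ
fromℚ p = record
  { cut       = ℚ._< p
  ; inhabited = p ℚ.- 1ℚ , subst (p ℚ.- 1ℚ ℚ.<_) (ℚ.+-identityʳ p) (ℚ.+-monoʳ-< p (ℚ.negative⁻¹ (ℚ.- 1ℚ)))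
  ; proper    = p , ℚ.<-irrefl refl
  ; downward  = ℚ.<-trans
  ; no-max    = ℚ.<-dense
  }

0ℝ : ℝ
0ℝ = fromℚ 0ℚ

below-bound : (a : ℝ) → ∀ {q b} → q ∈ cut a → b ∉ cut a → q ℚ.< b
below-bound a {q} {b} q∈a b∉a with ℚ.<-cmp q b
... | tri< q<b _ _ = q<b
... | tri≈ _ refl _ = ⊥-elim (b∉a q∈a)
... | tri> _ _ b<q = ⊥-elim (b∉a (ℝ.downward a b<q q∈a))

_+_ : ℝ → ℝ → ℝ
a + b = record
  { cut       = λ q → ∃₂ λ r s → r ∈ cut a × s ∈ cut b × q ≡ r ℚ.+ s
  ; inhabited = let r , r∈a = ℝ.inhabited a
                    s , s∈b = ℝ.inhabited b
                in r ℚ.+ s , r , s , r∈a , s∈b , refl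
  ; proper    = let u , u∉a = ℝ.proper a
                    v , v∉b = ℝ.proper b
                in u ℚ.+ v , λ (r , s , r∈a , s∈b , eq) →
                     ℚ.<-irrefl (sym eq) (ℚ.+-mono-< (below-bound a r∈a u∉a) (below-bound b s∈b v∉b))
  ; downward  = λ { {p} p<q (r , s , r∈a , s∈b , refl) →
                    p ℚ.- s , s
                  , ℝ.downward a (subst (p ℚ.- s ℚ.<_) (cancel₁ r s) (ℚ.+-monoˡ-< (ℚ.- s) p<q)) r∈a
                  , s∈b
                  , sym (cancel₂ p s) }
  ; no-max    = λ { (r , s , r∈a , s∈b , refl) →
                    let r′ , r<r′ , r′∈a = ℝ.no-max a r∈a
                    in r′ ℚ.+ s , ℚ.+-monoˡ-< s r<r′ , r′ , s , r′∈a , s∈b , refl }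
  }
  where
  cancel₁ : ∀ r s → (r ℚ.+ s) ℚ.- s ≡ r
  cancel₁ r s = trans (ℚ.+-assoc r s (ℚ.- s))
                (trans (cong (r ℚ.+_) (ℚ.+-inverseʳ s)) (ℚ.+-identityʳ r))

  cancel₂ : ∀ p s → (p ℚ.- s) ℚ.+ s ≡ p
  cancel₂ p s = trans (ℚ.+-assoc p (ℚ.- s) s)
                (trans (cong (p ℚ.+_) (ℚ.+-inverseˡ s)) (ℚ.+-identityʳ p))

-- Topological spaces.  The underlying set is a setoid, so that the points
-- of a countable power are sequences up to pointwise equality.

record TopologicalSpace : Set₂ where
  field
    setoid : Setoid 0ℓ 0ℓ

  open Setoid setoid public using (Carrier; _≈_)

  field
    IsOpen       : Pred Carrier 0ℓ → Set₁
    open-resp-≈  : ∀ {V} → IsOpen V → V Respects _≈_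
    open-resp-≐  : ∀ {V W} → V ≐ W → IsOpen V → IsOpen W
    whole-open   : IsOpen U
    ∩-open       : ∀ {V W} → IsOpen V → IsOpen W → IsOpen (V ∩ W)
    -- The empty set is the union over I = ⊥.
    ⋃-open       : (I : Set) (V : I → Pred Carrier 0ℓ) → (∀ i → IsOpen (V i)) → IsOpen (⋃ I V)

open TopologicalSpace using (Carrier; IsOpen)

infixr 7 _×ₜ_

_×ₜ_ : TopologicalSpace → TopologicalSpace → TopologicalSpace
X ×ₜ Y = record
  { setoid      = ×-setoid X.setoid Y.setoid
  ; IsOpen      = λ O → ∀ p → p ∈ O →
                    ∃₂ λ V W → X.IsOpen V × Y.IsOpen W × p ∈ (V ⟨×⟩ W) × (V ⟨×⟩ W) ⊆ O
  ; open-resp-≈ = λ O-open {p} (x≈x′ , y≈y′) p∈O →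
                    let V , W , V-open , W-open , (x∈V , y∈W) , VW⊆O = O-open p p∈O
                    in VW⊆O (X.open-resp-≈ V-open x≈x′ x∈V , Y.open-resp-≈ W-open y≈y′ y∈W)
  ; open-resp-≐ = λ (O⊆O′ , O′⊆O) O-open p p∈O′ →
                    let V , W , V-open , W-open , p∈VW , VW⊆O = O-open p (O′⊆O p∈O′)
                    in V , W , V-open , W-open , p∈VW , λ q∈VW → O⊆O′ (VW⊆O q∈VW)
  ; whole-open  = λ _ _ → U , U , X.whole-open , Y.whole-open , (tt , tt) , λ _ → tt
  ; ∩-open      = λ O-open O′-open p (p∈O , p∈O′) →
                    let V , W , V-open , W-open , (x∈V , y∈W) , VW⊆O = O-open p p∈O
                        V′ , W′ , V′-open , W′-open , (x∈V′ , y∈W′) , VW⊆O′ = O′-open p p∈O′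
                    in V ∩ V′ , W ∩ W′ , X.∩-open V-open V′-open , Y.∩-open W-open W′-open
                     , ((x∈V , x∈V′) , (y∈W , y∈W′))
                     , λ ((x∈V , x∈V′) , (y∈W , y∈W′)) → VW⊆O (x∈V , y∈W) , VW⊆O′ (x∈V′ , y∈W′)
  ; ⋃-open      = λ I O O-open p (i , p∈O) →
                    let V , W , V-open , W-open , p∈VW , VW⊆O = O-open i p p∈O
                    in V , W , V-open , W-open , p∈VW , λ q∈VW → i , VW⊆O q∈VW
  }
  where
  module X = TopologicalSpace X
  module Y = TopologicalSpace Y

Box : {A : Set} → (ℕ → Pred A 0ℓ) → Pred (ℕ → A) 0ℓ
Box V x = ∀ i → x i ∈ V i

infix 8 _^ℕ

_^ℕ : TopologicalSpace → TopologicalSpace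
X ^ℕ = record
  { setoid      = record
      { Carrier       = ℕ → X.Carrier
      ; _≈_           = λ x y → ∀ i → x i X.≈ y i
      ; isEquivalence = record
          { refl  = λ _ → S.refl
          ; sym   = λ x≈y i → S.sym (x≈y i)
          ; trans = λ x≈y y≈z i → S.trans (x≈y i) (y≈z i)
          }
      }
  ; IsOpen      = λ O → ∀ x → x ∈ O →
                    Σ[ V ∈ (ℕ → Pred X.Carrier 0ℓ) ]
                      (∀ i → X.IsOpen (V i))
                    × (∃[ n ] ∀ i → n ℕ.≤ i → Universal (V i))
                    × x ∈ Box V
                    × Box V ⊆ O
  ; open-resp-≈ = λ O-open {x} x≈y x∈O →
                    let V , V-open , _ , x∈V , V⊆O = O-open x x∈O
                    in V⊆O (λ i → X.open-resp-≈ (V-open i) (x≈y i) (x∈V i))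
  ; open-resp-≐ = λ (O⊆O′ , O′⊆O) O-open x x∈O′ →
                    let V , V-open , fin , x∈V , V⊆O = O-open x (O′⊆O x∈O′)
                    in V , V-open , fin , x∈V , λ y∈V → O⊆O′ (V⊆O y∈V)
  ; whole-open  = λ _ _ → (λ _ → U) , (λ _ → X.whole-open) , (0 , λ _ _ _ → tt) , (λ _ → tt) , λ _ → tt
  ; ∩-open      = λ O-open O′-open x (x∈O , x∈O′) →
                    let V , V-open , (m , V-fin) , x∈V , V⊆O = O-open x x∈O
                        W , W-open , (n , W-fin) , x∈W , W⊆O′ = O′-open x x∈O′
                    in (λ i → V i ∩ W i)
                     , (λ i → X.∩-open (V-open i) (W-open i))
                     , (m ℕ.⊔ n , λ i m⊔n≤i a → V-fin i (ℕ.m⊔n≤o⇒m≤o m n m⊔n≤i) a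
                                              , W-fin i (ℕ.m⊔n≤o⇒n≤o m n m⊔n≤i) a)
                     , (λ i → x∈V i , x∈W i)
                     , λ y∈VW → V⊆O (proj₁ ∘ y∈VW) , W⊆O′ (proj₂ ∘ y∈VW)
  ; ⋃-open      = λ I O O-open x (i , x∈O) →
                    let V , V-open , fin , x∈V , V⊆O = O-open i x x∈O
                    in V , V-open , fin , x∈V , λ y∈V → i , V⊆O y∈V
  }
  where
  module X = TopologicalSpace X
  module S = Setoid X.setoid

record Metric (S : Setoid 0ℓ 0ℓ) : Set₁ where
  open Setoid S using (_≈_) renaming (Carrier to A)
  field
    d        : A → A → ℝ
    d-nonneg : ∀ x y → 0ℝ ≤ d x y
    d-zero   : ∀ x y → d x y ≃ 0ℝ ⇔ x ≈ y
    d-sym    : ∀ x y → d x y ≃ d y x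
    triangle : ∀ x y z → d x z ≤ d x y + d y z

  MetricOpen : Pred A 0ℓ → Set₁
  MetricOpen V = ∀ x → x ∈ V → ∃[ ε ] 0ℝ < ε × (∀ y → d x y < ε → y ∈ V)

  Cauchy : (ℕ → A) → Set₁
  Cauchy s = ∀ ε → 0ℝ < ε → ∃[ N ] ∀ m n → N ℕ.≤ m → N ℕ.≤ n → d (s m) (s n) < ε

  ConvergesTo : (ℕ → A) → A → Set₁
  ConvergesTo s x = ∀ ε → 0ℝ < ε → ∃[ N ] ∀ n → N ℕ.≤ n → d (s n) x < ε

  Complete : Set₁
  Complete = ∀ s → Cauchy s → ∃[ x ] ConvergesTo s x

module _ (X : TopologicalSpace) where
  open TopologicalSpace X using (setoid; _≈_)

  -- Enumerations are partial so that the empty set is countable and the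
  -- empty space is separable.
  Countable : Pred (Carrier X) 0ℓ → Set
  Countable D = Σ[ e ∈ (ℕ → Maybe (Carrier X)) ]
    (∀ x → x ∈ D → ∃₂ λ n y → e n ≡ just y × y ≈ x)

  Dense : Pred (Carrier X) 0ℓ → Set₁
  Dense D = ∀ V → IsOpen X V → ∃ V → D ≬ V

  Separable : Set₁
  Separable = ∃[ D ] Countable D × Dense D

  CompletelyMetrizable : Set₁
  CompletelyMetrizable = Σ[ M ∈ Metric setoid ]
    Metric.Complete M × (∀ V → IsOpen X V ⇔ Metric.MetricOpen M V)

  IsPolish : Set₁
  IsPolish = Separable × CompletelyMetrizable

-- Borel sets: the σ-algebra generated by the open sets.

data Borel (X : TopologicalSpace) : Pred (Carrier X) 0ℓ → Set₁ where
  isOpen     : ∀ {A} → IsOpen X A → Borel X A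
  complement : ∀ {A} → Borel X A → Borel X (∁ A)
  union      : (A : ℕ → Pred (Carrier X) 0ℓ) → (∀ n → Borel X (A n)) → Borel X (⋃ ℕ A)
  -- Sets are predicates up to extensional equality.
  resp-≐     : ∀ {A B} → A ≐ B → Borel X A → Borel X B

record EquivalenceRelation (X : TopologicalSpace) (ℓ : Level) : Set (suc ℓ) where
  open TopologicalSpace X using (_≈_)
  field
    _∼_           : Rel (Carrier X) ℓ
    isEquivalence : IsEquivalence _∼_
    -- A relation on the setoid of points, i.e. compatible with its equality.
    ≈⇒∼           : _≈_ ⇒ _∼_

record SimpleGraph (X : TopologicalSpace) : Set₁ where
  open TopologicalSpace X using (_≈_)
  field
    Adj         : Rel (Carrier X) 0ℓ
    symmetric   : Symmetric Adj
    irreflexive : Irreflexive _≈_ Adj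

  data Path : Rel (Carrier X) 0ℓ where
    stop : ∀ {x y} → x ≈ y → Path x y
    step : ∀ {x y z} → Adj x y → Path y z → Path x z

BorelGraphable : ∀ {ℓ} (X : TopologicalSpace) → EquivalenceRelation X ℓ → Set (suc 0ℓ ⊔ ℓ)
BorelGraphable X E = Σ[ G ∈ SimpleGraph X ]
    Borel (X ×ₜ X) (uncurry (SimpleGraph.Adj G))
  × (∀ x y → SimpleGraph.Path G x y ⇔ EquivalenceRelation._∼_ E x y)

module _ {ℓ} {X : TopologicalSpace} (E : EquivalenceRelation X ℓ) where
  open EquivalenceRelation E
  private module E = IsEquivalence isEquivalence

  [_] : Carrier X → Pred (Carrier X) ℓ
  [ x ] = x ∼_

  -- The set of classes {[xᵢ] : i ∈ ℕ}; a class is a predicate up to _≐_.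
  Classes : (ℕ → Carrier X) → Pred (Pred (Carrier X) ℓ) ℓ
  Classes x C = ∃[ i ] C ≐ [ x i ]

  infix 8 _⁺

  _⁺ : EquivalenceRelation (X ^ℕ) (suc ℓ)
  _⁺ = record
    { _∼_           = λ x y → Classes x ≐ Classes y
    ; isEquivalence = record { refl = ≐-refl ; sym = ≐-sym ; trans = ≐-trans }
    ; ≈⇒∼           = λ x≈y →
          (λ (i , C≐) → i , ≐-trans C≐ (class-cong (≈⇒∼ (x≈y i))))
        , (λ (i , C≐) → i , ≐-trans C≐ (class-cong (E.sym (≈⇒∼ (x≈y i)))))
    }
    where
    class-cong : ∀ {x y} → x ∼ y → [ x ] ≐ [ y ]
    class-cong x∼y = E.trans (E.sym x∼y) , E.trans x∼y

{-# OPTIONS --safe #-}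
-- Let G be a Borel graph generating E.  Say that z extends x if every xᵢ occurs
-- in z and every entry of z is joined to an entry equal to some xᵢ by a G-path
-- all of whose vertices are entries of z.  Only the countably many entries of z
-- are quantified over, so this relation is Borel, and it implies x E⁺ z.
-- Conversely, if x E⁺ y then a sequence z listing the vertices of a G-path from
-- each xᵢ to some yⱼ and from each yⱼ to some xᵢ extends both x and y.  Hence
-- the symmetrisation of the relation, off the diagonal, graphs E⁺.
module Submission where

open import Level using (0ℓ)
open import Axiom.ExcludedMiddle using (ExcludedMiddle)
open import Data.Empty using (⊥-elim)
open import Data.Nat.Base as ℕ using (ℕ; zero; suc)
import Data.Nat.Properties as ℕ
open import Data.Product using (Σ-syntax; ∃-syntax; _×_; _,_; proj₁; proj₂; uncurry)
open import Data.Rational.Base as ℚ using (ℚ; 0ℚ; ½)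
import Data.Rational.Properties as ℚ
open import Data.Sum.Base as Sum using (_⊎_; inj₁; inj₂)
open import Data.Unit.Base using (tt)
open import Function.Base using (_∘_; _on_; id)
open import Function.Bundles using (Equivalence; mk⇔)
open import Relation.Binary.Bundles using (Setoid)
open import Relation.Binary.Construct.Closure.ReflexiveTransitive using (Star; ε; _◅_; _◅◅_; reverse; fold)
open import Relation.Binary.Core using (Rel)
open import Relation.Binary.Definitions using (_Respects_)
open import Relation.Binary.PropositionalEquality using (_≡_; refl; sym; trans; cong; subst; subst₂)
open import Relation.Binary.Structures using (IsEquivalence)
open import Relation.Nullary using (yes; no; ¬_)
open import Relation.Nullary.Decidable using (decidable-stable)
open import Relation.Unary using (Pred; _∈_; _∉_; _⊆_; _∩_; _∪_; ∁; ⋂)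
open import Defs

open TopologicalSpace using (Carrier; IsOpen; open-resp-≈; open-resp-≐; ∩-open; ⋃-open; whole-open)
open ℝ using (cut)

-- Continuous maps

Continuous : (X Y : TopologicalSpace) → (Carrier X → Carrier Y) → Set₁
Continuous X Y f = ∀ V → IsOpen Y V → IsOpen X (V ∘ f)

fst-continuous : ∀ X Y → Continuous (X ×ₜ Y) X proj₁
fst-continuous X Y V V-open p p∈V =
  V , _ , V-open , whole-open Y , (p∈V , tt) , proj₁

snd-continuous : ∀ X Y → Continuous (X ×ₜ Y) Y proj₂
snd-continuous X Y V V-open p p∈V =
  _ , V , whole-open X , V-open , (tt , p∈V) , proj₂

-- Openness in a product is witnessed one point at a time, so the preimage is rebuilt as a union of
-- open sets indexed by its own points.
pair-continuous : ∀ {X Y} Z {f g} → Continuous Z X f → Continuous Z Y g →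
                  Continuous Z (X ×ₜ Y) (λ z → f z , g z)
pair-continuous Z {f} {g} f-cont g-cont O O-open =
  open-resp-≐ Z
    ( (λ (i , m) → let _ , _ , _ , _ , _ , VW⊆O = nbhd i in VW⊆O m)
    , (λ {z} z∈O → let _ , _ , _ , _ , m , _ = nbhd (z , z∈O) in (z , z∈O) , m))
    (⋃-open Z (Σ[ z ∈ Carrier Z ] (f z , g z) ∈ O) _ λ i →
      let V , W , V-open , W-open , _ = nbhd i
      in ∩-open Z (f-cont V V-open) (g-cont W W-open))
  where
  nbhd = λ ((z , z∈O) : Σ[ z ∈ Carrier Z ] (f z , g z) ∈ O) → O-open (f z , g z) z∈O

eval-continuous : ∀ X k → Continuous (X ^ℕ) X (λ x → x k)
eval-continuous X k V V-open x xk∈V =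
    -- The implication gives the factor `V` at `k` and the whole space elsewhere; from `suc k` on it
    -- holds vacuously.
    (λ i a → i ≡ k → a ∈ V)
  , slice-open
  , (suc k , λ i k<i a i≡k → ⊥-elim (ℕ.<⇒≢ k<i (sym i≡k)))
  , (λ { i refl → xk∈V })
  , λ y∈ → y∈ k refl
  where
  slice-open : ∀ i → IsOpen X (λ a → i ≡ k → a ∈ V)
  slice-open i with i ℕ.≟ k
  ... | yes i≡k = open-resp-≐ X ((λ a∈V _ → a∈V) , (λ h → h i≡k)) V-open
  ... | no  i≢k = open-resp-≐ X ((λ _ i≡k → ⊥-elim (i≢k i≡k)) , _) (whole-open X)

∘-continuous : ∀ {X Y Z f g} → Continuous Y Z g → Continuous X Y f → Continuous X Z (g ∘ f)
∘-continuous {g = g} g-cont f-cont V V-open = f-cont (V ∘ g) (g-cont V V-open)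

-- Borel sets

Borel-preimage : ∀ {X Y f} → Continuous X Y f → ∀ {A} → Borel Y A → Borel X (A ∘ f)
Borel-preimage f-cont (isOpen A-open)     = isOpen (f-cont _ A-open)
Borel-preimage f-cont (complement A)      = complement (Borel-preimage f-cont A)
Borel-preimage f-cont (union A A-borel)   = union _ λ n → Borel-preimage f-cont (A-borel n)
Borel-preimage {f = f} f-cont (resp-≐ (A⊆B , B⊆A) A) =
  resp-≐ ((λ {x} → A⊆B {f x}) , (λ {x} → B⊆A {f x})) (Borel-preimage f-cont A)

-- Induction on the construction. Applied later to `Extends`, it avoids unfolding that relation.
Borel-resp-≈ : ∀ {X A} → Borel X A → A Respects TopologicalSpace._≈_ X
Borel-resp-≈ {X} (isOpen A-open)   x≈y x∈A = open-resp-≈ X A-open x≈y x∈A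
Borel-resp-≈ {X} (complement A)    x≈y x∉A y∈A =
  x∉A (Borel-resp-≈ A (Setoid.sym (TopologicalSpace.setoid X) x≈y) y∈A)
Borel-resp-≈ (union A A-borel)     x≈y (n , x∈A) = n , Borel-resp-≈ (A-borel n) x≈y x∈A
Borel-resp-≈ (resp-≐ (A⊆B , B⊆A) A) x≈y x∈B = A⊆B (Borel-resp-≈ A x≈y (B⊆A x∈B))

Borel-∪ : ∀ {X A B} → Borel X A → Borel X B → Borel X (A ∪ B)
Borel-∪ {X} {A} {B} A-borel B-borel =
  resp-≐ ((λ { (zero , m) → inj₁ m ; (suc _ , m) → inj₂ m })
         , λ { (inj₁ m) → 0 , m ; (inj₂ m) → 1 , m })
         (union pieces λ { zero → A-borel ; (suc _) → B-borel })
  where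
  pieces : ℕ → Pred (Carrier X) 0ℓ
  pieces zero    = A
  pieces (suc _) = B

module _ (em : ExcludedMiddle 0ℓ) where

  Borel-⋂ : ∀ {X} {A : ℕ → Pred (Carrier X) 0ℓ} → (∀ n → Borel X (A n)) → Borel X (⋂ ℕ A)
  Borel-⋂ A-borel =
    resp-≐ ((λ h n → decidable-stable em λ ¬a → h (n , ¬a)) , λ h (n , ¬a) → ¬a (h n))
           (complement (union _ λ n → complement (A-borel n)))

  Borel-∩ : ∀ {X A B} → Borel X A → Borel X B → Borel X (A ∩ B)
  Borel-∩ A B =
    resp-≐ ( (λ h → decidable-stable em (h ∘ inj₁) , decidable-stable em (h ∘ inj₂))
           , λ (a , b) → Sum.[ (λ ¬a → ¬a a) , (λ ¬b → ¬b b) ])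
           (complement (Borel-∪ (complement A) (complement B)))

-- The diagonal of a metrizable space

half+half : ∀ p → ½ ℚ.* p ℚ.+ ½ ℚ.* p ≡ p
half+half p = trans (sym (ℚ.*-distribʳ-+ p ½ ½)) (ℚ.*-identityˡ p)

half-positive : ∀ {p} → 0ℚ ℚ.< p → 0ℚ ℚ.< ½ ℚ.* p
half-positive {p} 0<p = subst (ℚ._< ½ ℚ.* p) (ℚ.*-zeroʳ ½) (ℚ.*-monoʳ-<-pos ½ 0<p)

-- `q ∉ cut a` says that `a` is at most `q`, and upper bounds add.
∉-+ : ∀ a b {q s} → q ∉ cut a → s ∉ cut b → q ℚ.+ s ∉ cut (a + b)
∉-+ a b q∉a s∉b (u , v , u∈a , v∈b , eq) =
  ℚ.<-irrefl (sym eq) (ℚ.+-mono-< (below-bound a u∈a q∉a) (below-bound b v∈b s∉b))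

module _ {S : Setoid 0ℓ 0ℓ} (M : Metric S) where
  open Metric M
  open Setoid S using (_≈_) renaming (Carrier to A)

  Ball : A → ℚ → Pred A 0ℓ
  Ball x r y = d x y < fromℚ r

  Ball-open : ∀ x r → MetricOpen (Ball x r)
  Ball-open x r y (q , q<r , q∉) =
      -- Since `q` bounds `d x y` from above and `q < r`, the triangle inequality leaves room
      -- `r - q` around `y`.
      fromℚ (r ℚ.- q)
    , (0ℚ , subst (ℚ._< r ℚ.- q) (ℚ.+-inverseʳ q) (ℚ.+-monoˡ-< (ℚ.- q) q<r) , ℚ.<-irrefl refl)
    , λ z (s , s<r-q , s∉) →
        q ℚ.+ s
      , subst (q ℚ.+ s ℚ.<_) (cancel q r) (ℚ.+-monoʳ-< q s<r-q)
      , ∉-+ (d x y) (d y z) q∉ s∉ ∘ triangle x y z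
    where
    cancel : ∀ q r → q ℚ.+ (r ℚ.- q) ≡ r
    cancel q r = trans (ℚ.+-comm q (r ℚ.- q))
                 (trans (ℚ.+-assoc r (ℚ.- q) q)
                 (trans (cong (r ℚ.+_) (ℚ.+-inverseˡ q)) (ℚ.+-identityʳ r)))

  Ball-centre : ∀ x {r} → 0ℚ ℚ.< r → x ∈ Ball x r
  Ball-centre x 0<r =
    0ℚ , 0<r , λ 0∈ → ℚ.<-irrefl refl (proj₁ (Equivalence.from (d-zero x x) (Setoid.refl S)) 0∈)

  -- A common point would bound `d x y` by a rational smaller than `p`.
  half-Balls-disjoint : ∀ x y {p} → p ∈ cut (d x y) →
                        ∀ {z} → z ∈ Ball x (½ ℚ.* p) → z ∉ Ball y (½ ℚ.* p)
  half-Balls-disjoint x y {p} p∈ {z} (q , q<r , q∉) (s , s<r , s∉) =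
    ∉-+ (d x z) (d z y) q∉ (s∉ ∘ proj₁ (d-sym z y))
      (triangle x z y (ℝ.downward (d x y) (subst (q ℚ.+ s ℚ.<_) (half+half p) (ℚ.+-mono-< q<r s<r)) p∈))

  -- Were 0 outside the cut, the distance would be at most 0, hence zero. So 0 lies in the cut,
  -- which has no greatest element.
  apart : ExcludedMiddle 0ℓ → ∀ {x y} → ¬ x ≈ y → ∃[ p ] 0ℚ ℚ.< p × p ∈ cut (d x y)
  apart em {x} {y} x≉y = ℝ.no-max (d x y) (decidable-stable em λ 0∉ →
    x≉y (Equivalence.to (d-zero x y) ((λ p∈ → below-bound (d x y) p∈ 0∉) , d-nonneg x y)))

module _ (em : ExcludedMiddle 0ℓ) (X : TopologicalSpace) (metrizable : CompletelyMetrizable X) where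
  open TopologicalSpace X using (_≈_)
  private M = proj₁ metrizable

  -- The diagonal is closed: unequal points have disjoint balls, with radius half of a positive
  -- rational below their distance.
  Borel-≈ : Borel (X ×ₜ X) (uncurry _≈_)
  Borel-≈ = resp-≐ (decidable-stable em , λ x≈y x≉y → x≉y x≈y) (complement (isOpen ≉-open))
    where
    ball-open : ∀ x r → IsOpen X (Ball M x r)
    ball-open x r = Equivalence.from (proj₂ (proj₂ metrizable) _) (Ball-open M x r)

    ≉-open : IsOpen (X ×ₜ X) (∁ (uncurry _≈_))
    ≉-open (x , y) x≉y =
      let p , 0<p , p∈ = apart M em x≉y
          r = ½ ℚ.* p
      in Ball M x r , Ball M y r , ball-open x r , ball-open y r
       , (Ball-centre M x (half-positive 0<p) , Ball-centre M y (half-positive 0<p))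
       , λ (v∈ , w∈) v≈w →
           half-Balls-disjoint M x y p∈ (open-resp-≈ X (ball-open x r) v≈w v∈) w∈

-- Cantor's enumeration of ℕ × ℕ

next : ℕ × ℕ → ℕ × ℕ
next (zero  , k) = suc k , zero
next (suc i , k) = i , suc k

unpair : ℕ → ℕ × ℕ
unpair zero    = zero , zero
unpair (suc n) = next (unpair n)

unpair-surjective : ∀ i k → ∃[ n ] unpair n ≡ (i , k)
unpair-surjective i k = along-diagonal i k (i ℕ.+ k) refl
  where
  -- The sum `s` is carried for termination: each call lowers `(s, k)` lexicographically, going back
  -- one place in the enumeration.
  along-diagonal : ∀ i k s → i ℕ.+ k ≡ s → ∃[ n ] unpair n ≡ (i , k)
  along-diagonal zero    zero    s       _  = 0 , refl
  along-diagonal (suc i) zero    (suc s) eq =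
    let n , e = along-diagonal zero i s (trans (sym (ℕ.+-identityʳ i)) (ℕ.suc-injective eq))
    in suc n , cong next e
  along-diagonal i       (suc k) s       eq =
    let n , e = along-diagonal (suc i) k s (trans (sym (ℕ.+-suc i k)) eq)
    in suc n , cong next e

-- Extensions of a sequence along a graph

module _ {X : TopologicalSpace} (G : SimpleGraph X) where
  open TopologicalSpace X using (setoid; _≈_)
  open SimpleGraph G
  private module S = Setoid setoid

  -- Standing still is allowed, so that links can follow padded vertex lists and pass between
  -- indices that hold the same point.
  Near : Rel (Carrier X) 0ℓ
  Near a b = a ≈ b ⊎ Adj a b

  Near-sym : ∀ {a b} → Near a b → Near b a
  Near-sym = Sum.map S.sym symmetric

  Linked : (ℕ → Carrier X) → Rel ℕ 0ℓ
  Linked z = Star (Near on z)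

  Extends : Rel (ℕ → Carrier X) 0ℓ
  Extends x z = (∀ i → ∃[ j ] x i ≈ z j)
              × (∀ j → ∃[ i ] ∃[ k ] x i ≈ z k × Linked z k j)

  -- Past its end, a path repeats its last vertex.
  vertex : ∀ {a b} → Path a b → ℕ → Carrier X
  vertex {a}     (stop _)   zero    = a
  vertex {b = b} (stop _)   (suc k) = b
  vertex {a}     (step _ p) zero    = a
  vertex         (step _ p) (suc k) = vertex p k

  vertex-start : ∀ {a b} (p : Path a b) → vertex p 0 ≡ a
  vertex-start (stop _)   = refl
  vertex-start (step _ _) = refl

  vertex-end : ∀ {a b} (p : Path a b) → ∃[ k ] vertex p k ≡ b
  -- Index 0 holds the start, which equals the end only up to `≈`; hence 1.
  vertex-end (stop _)   = 1 , refl
  vertex-end (step _ p) = let k , e = vertex-end p in suc k , e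

  vertex-near : ∀ {a b} (p : Path a b) k → Near (vertex p k) (vertex p (suc k))
  vertex-near (stop a≈b)   zero    = inj₁ a≈b
  vertex-near (stop _)     (suc k) = inj₁ S.refl
  vertex-near (step adj p) zero    = inj₂ (subst (Adj _) (sym (vertex-start p)) adj)
  vertex-near (step _ p)   (suc k) = vertex-near p k

  -- A common extension built from paths

  module CommonExtension {x y : ℕ → Carrier X}
    (x⇝y : ∀ i → ∃[ j ] Path (x i) (y j))
    (y⇝x : ∀ j → ∃[ i ] Path (y j) (x i)) where

    -- The first coordinate is 0 for the paths out of x and positive for those out of y.
    point : ℕ × ℕ → ℕ → Carrier X
    point (zero  , i) = vertex (proj₂ (x⇝y i))
    point (suc _ , j) = vertex (proj₂ (y⇝x j))

    point-near : ∀ c k → Near (point c k) (point c (suc k))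
    point-near (zero  , i) = vertex-near (proj₂ (x⇝y i))
    point-near (suc _ , j) = vertex-near (proj₂ (y⇝x j))

    -- An index codes a path together with a position on it; the path is in turn coded by its side
    -- and its number.
    z : ℕ → Carrier X
    z n = let c , k = unpair n in point (unpair c) k

    index : ∀ c k → ∃[ n ] z n ≡ point c k
    index (t , i) k with unpair-surjective t i
    ... | c , e with unpair-surjective c k
    ...   | n , e′ = n , trans (cong (λ (c , k) → point (unpair c) k) e′) (cong (λ c → point c k) e)

    -- Induction along the path. The index `n` is arbitrary because a vertex may be listed at an
    -- index other than the one chosen by `index`.
    linked-start : ∀ c k n → z n ≡ point c k → Linked z (proj₁ (index c 0)) n
    linked-start c zero    n e = inj₁ (S.reflexive (trans (proj₂ (index c 0)) (sym e))) ◅ ε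
    linked-start c (suc k) n e =
      let m , e′ = index c k
      in linked-start c k m e′
           ◅◅ _◅_ {j = n} (subst₂ Near (sym e′) (sym e) (point-near c k)) ε

    -- Go back to the start of the path, then forward to `n`. Both directions are needed since the
    -- anchor may be at the far end.
    linked : ∀ n k → Linked z (proj₁ (index (unpair (proj₁ (unpair n))) k)) n
    linked n k =
      let c = unpair (proj₁ (unpair n))
          m , e = index c k
      in reverse Near-sym (linked-start c k m e) ◅◅ linked-start c (proj₂ (unpair n)) n refl

    extends : ∀ {w : ℕ → Carrier X} →
              (∀ i → ∃[ c ] ∃[ k ] point c k ≡ w i) →
              (∀ c → ∃[ i ] ∃[ k ] point c k ≡ w i) →
              Extends w z
    extends occurs anchored =
        (λ i → let c , k , e = occurs i
                   n , e′ = index c k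
               in n , S.reflexive (sym (trans e′ e)))
      , (λ n → let c = unpair (proj₁ (unpair n))
                   i , k , e = anchored c
               in i , proj₁ (index c k) , S.reflexive (sym (trans (proj₂ (index c k)) e))
                , linked n k)

    extends-x : Extends x z
    extends-x = extends
      (λ i → (0 , i) , 0 , vertex-start (proj₂ (x⇝y i)))
      -- A path out of `x` is anchored at its start, a path out of `y` at its end.
      λ { (zero  , i) → i , 0 , vertex-start (proj₂ (x⇝y i))
        ; (suc _ , j) → let i , p = y⇝x j in i , vertex-end p }

    extends-y : Extends y z
    extends-y = extends
      (λ j → (1 , j) , 0 , vertex-start (proj₂ (y⇝x j)))
      λ { (zero  , i) → let j , p = x⇝y i in j , vertex-end p
        ; (suc _ , j) → j , 0 , vertex-start (proj₂ (y⇝x j)) }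

  -- Borelness of extension and the jump graph

  module _ (em : ExcludedMiddle 0ℓ) (metrizable : CompletelyMetrizable X)
           (Adj-borel : Borel (X ×ₜ X) (uncurry Adj)) where

    private
      X² = X ^ℕ ×ₜ X ^ℕ

      left : ∀ k → Continuous X² X (λ (x , z) → x k)
      left k = ∘-continuous {X²} {X ^ℕ} {X} (eval-continuous X k) (fst-continuous (X ^ℕ) (X ^ℕ))

      right : ∀ k → Continuous X² X (λ (x , z) → z k)
      right k = ∘-continuous {X²} {X ^ℕ} {X} (eval-continuous X k) (snd-continuous (X ^ℕ) (X ^ℕ))

      Borel-on : ∀ {f g R} → Continuous X² X f → Continuous X² X g →
                 Borel (X ×ₜ X) (uncurry R) → Borel X² (λ p → R (f p) (g p))
      Borel-on f-cont g-cont = Borel-preimage (pair-continuous {X} {X} X² f-cont g-cont)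

      ≈-borel = Borel-≈ em X metrizable

    -- With the length fixed, Borelness follows by induction on it, the intermediate index giving a
    -- countable union.
    LinkedBy : ℕ → (ℕ → Carrier X) → Rel ℕ 0ℓ
    LinkedBy zero    z k l = k ≡ l
    LinkedBy (suc n) z k l = ∃[ m ] Near (z k) (z m) × LinkedBy n z m l

    Linked⇒LinkedBy : ∀ {z k l} → Linked z k l → ∃[ n ] LinkedBy n z k l
    Linked⇒LinkedBy ε = 0 , refl
    Linked⇒LinkedBy (near ◅ s) = let n , t = Linked⇒LinkedBy s in suc n , _ , near , t

    LinkedBy⇒Linked : ∀ n {z k l} → LinkedBy n z k l → Linked z k l
    LinkedBy⇒Linked zero    refl = ε
    LinkedBy⇒Linked (suc n) (_ , near , t) = near ◅ LinkedBy⇒Linked n t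

    LinkedBy-borel : ∀ n k l → Borel X² (λ (x , z) → LinkedBy n z k l)
    -- The condition `k ≡ l` does not involve the point, so the whole space is a neighbourhood.
    LinkedBy-borel zero k l = isOpen λ p k≡l →
      _ , _ , whole-open (X ^ℕ) , whole-open (X ^ℕ) , (tt , tt) , λ _ → k≡l
    LinkedBy-borel (suc n) k l = union _ λ m →
      Borel-∩ em (Borel-∪ (Borel-on (right k) (right m) ≈-borel)
                          (Borel-on (right k) (right m) Adj-borel))
                 (LinkedBy-borel n m l)

    Linked-borel : ∀ k l → Borel X² (λ (x , z) → Linked z k l)
    Linked-borel k l = resp-≐ ((λ (n , t) → LinkedBy⇒Linked n t) , Linked⇒LinkedBy)
                              (union _ λ n → LinkedBy-borel n k l)

    Extends-borel : Borel X² (uncurry Extends)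
    Extends-borel = Borel-∩ em
      (Borel-⋂ em λ i → union _ λ j → Borel-on (left i) (right j) ≈-borel)
      (Borel-⋂ em λ j → union _ λ i → union _ λ k →
        Borel-∩ em (Borel-on (left i) (right k) ≈-borel) (Linked-borel k j))

    private
      _≈ℕ_ = TopologicalSpace._≈_ (X ^ℕ)
      module Sℕ = Setoid (TopologicalSpace.setoid (X ^ℕ))

    jumpGraph : SimpleGraph (X ^ℕ)
    jumpGraph = record
      { Adj         = λ x z → (Extends x z ⊎ Extends z x) × ¬ x ≈ℕ z
      ; symmetric   = λ (e , x≉z) → Sum.swap e , x≉z ∘ Sℕ.sym
      ; irreflexive = λ x≈z (_ , x≉z) → x≉z x≈z
      }

    jumpGraph-borel : Borel X² (uncurry (SimpleGraph.Adj jumpGraph))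
    jumpGraph-borel = Borel-∩ em
      (Borel-∪ Extends-borel
        (Borel-preimage
          (pair-continuous {X ^ℕ} {X ^ℕ} X² (snd-continuous (X ^ℕ) (X ^ℕ)) (fst-continuous (X ^ℕ) (X ^ℕ)))
          Extends-borel))
      (complement (Borel-⋂ em λ i → Borel-on (left i) (right i) ≈-borel))

    -- The path runs through `z`. As loops are excluded, an edge is dropped whenever `z` coincides
    -- with an endpoint.
    common-extension⇒Path : ∀ {x y z} → Extends x z → Extends y z → SimpleGraph.Path jumpGraph x y
    common-extension⇒Path {x} {y} {z} xz yz with em {x ≈ℕ z} | em {z ≈ℕ y}
    ... | yes x≈z | yes z≈y = SimpleGraph.stop (Sℕ.trans x≈z z≈y)
    ... | no  x≉z | yes z≈y = SimpleGraph.step (inj₁ xz , x≉z) (SimpleGraph.stop z≈y)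
    ... | no  x≉z | no  z≉y =
      SimpleGraph.step (inj₁ xz , x≉z) (SimpleGraph.step (inj₂ yz , z≉y) (SimpleGraph.stop Sℕ.refl))
    -- A path absorbs `≈` only at its end, so here `Extends y z` is transported to `Extends y x`.
    ... | yes x≈z | no  z≉y =
      SimpleGraph.step (inj₂ (Borel-resp-≈ Extends-borel (Sℕ.refl , Sℕ.sym x≈z) yz) , z≉y ∘ Sℕ.trans (Sℕ.sym x≈z))
                       (SimpleGraph.stop Sℕ.refl)

theorem7p6 : ExcludedMiddle 0ℓ → ∀ {ℓ} (X : TopologicalSpace) → IsPolish X → (E : EquivalenceRelation X ℓ) → BorelGraphable X E → BorelGraphable (X ^ℕ) (E ⁺)
theorem7p6 em X (_ , metrizable) E (G , Adj-borel , Path⇔∼) =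
    jumpGraph G em metrizable Adj-borel
  , jumpGraph-borel G em metrizable Adj-borel
  , λ x y → mk⇔ Path⇒∼⁺ ∼⁺⇒Path
  where
  open EquivalenceRelation E
  module E = IsEquivalence isEquivalence
  module E⁺ = EquivalenceRelation (E ⁺)
  module E⁺≡ = IsEquivalence E⁺.isEquivalence
  module G = SimpleGraph G
  module S = Setoid (TopologicalSpace.setoid X)
  module H = SimpleGraph (jumpGraph G em metrizable Adj-borel)

  ⊆-Classes : ∀ {x y} → (∀ i → ∃[ j ] x i ∼ y j) → Classes E x ⊆ Classes E y
  ⊆-Classes f (i , C⊆ , ⊆C) =
    let j , xi∼yj = f i
    in j , (λ c → E.trans (E.sym xi∼yj) (C⊆ c)) , λ c → ⊆C (E.trans xi∼yj c)

  ⊆-Classes⇒Path : ∀ {x y} → Classes E x ⊆ Classes E y → ∀ i → ∃[ j ] G.Path (x i) (y j)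
  ⊆-Classes⇒Path {x} {y} x⊆y i =
    -- Test the inclusion on the class of `x i` itself.
    let j , _ , yj⊆xi = x⊆y (i , id , id)
    in j , Equivalence.from (Path⇔∼ (x i) (y j)) (yj⊆xi E.refl)

  Near⇒∼ : ∀ {a b} → Near G a b → a ∼ b
  Near⇒∼ (inj₁ a≈b) = ≈⇒∼ a≈b
  Near⇒∼ (inj₂ adj) = Equivalence.to (Path⇔∼ _ _) (G.step adj (G.stop S.refl))

  Linked⇒∼ : ∀ {z k l} → Linked G z k l → z k ∼ z l
  Linked⇒∼ {z} = fold (_∼_ on z) (λ near → E.trans (Near⇒∼ near)) E.refl

  -- Occurrence gives one inclusion. The links give the other, since they keep each entry of `z` in
  -- the class of some `x i`.
  Extends⇒∼⁺ : ∀ {x z} → Extends G x z → x E⁺.∼ z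
  Extends⇒∼⁺ (occurs , anchored) =
      ⊆-Classes (λ i → let j , xi≈zj = occurs i in j , ≈⇒∼ xi≈zj)
    , ⊆-Classes (λ j → let i , k , xi≈zk , l = anchored j
                       in i , E.sym (E.trans (≈⇒∼ xi≈zk) (Linked⇒∼ l)))

  Path⇒∼⁺ : ∀ {x y} → H.Path x y → x E⁺.∼ y
  Path⇒∼⁺ (H.stop x≈y) = E⁺.≈⇒∼ x≈y
  Path⇒∼⁺ (H.step (inj₁ e , _) p) = E⁺≡.trans (Extends⇒∼⁺ e) (Path⇒∼⁺ p)
  Path⇒∼⁺ (H.step (inj₂ e , _) p) = E⁺≡.trans (E⁺≡.sym (Extends⇒∼⁺ e)) (Path⇒∼⁺ p)

  ∼⁺⇒Path : ∀ {x y} → x E⁺.∼ y → H.Path x y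
  ∼⁺⇒Path (x⊆y , y⊆x) = common-extension⇒Path G em metrizable Adj-borel extends-x extends-y
    where open CommonExtension G (⊆-Classes⇒Path x⊆y) (⊆-Classes⇒Path y⊆x)
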